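{- Let $G$ be a finite simple undirected connected graph with vertex set $V$, $|V|=n$, edge set $E$, $|E|=m\ge 1$, vertex degrees $d_i$ ($i\in V$) and radius $r$. Put $$\nu=\frac{n\sum_{i\in V}d_i^2}{4m^2},\qquad H(G)=\sum_{ij\in E}\frac{2}{d_i+d_j}.$$ Then $$H(G)\ge\frac{n}{2\nu}\ge\frac{m}{n-r}.$$
   Context: The quantity $\nu$ is a measure of irregularity of $G$, defined for graphs with at least one edge. $H(G)$ is the Harmonic index of $G$; the sum runs over each (unordered) edge once. The eccentricity $ecc(v)$ of a vertex $v$ in a connected graph $G$ is the maximum distance between $v$ and any other vertex of $G$; the radius $r$ is the minimum eccentricity over all vertices of $G$. -}

module Defs where

open import Data.Fin.Base as Fin using (Fin; zero; suc; toℕ)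
open import Data.Fin.Properties as Fin using (toℕ≤pred[n]; pigeonhole)
open import Data.Integer.Base using (+_)
open import Data.List.Base using (List; []; _∷_; length; map; mapMaybe; filter; foldr; allFin; cartesianProduct)
open import Data.List.Membership.Propositional using (_∈_; lose)
open import Data.List.Membership.Propositional.Properties using (∈-allFin; ∈-map⁺)
open import Data.List.Properties using (filter-some)
open import Data.List.Relation.Unary.Any using (here; there)
open import Data.Maybe.Base as Maybe using (Maybe)
open import Data.Nat.Base hiding (_/_)
open import Data.Nat.ListAction using (sum)
open import Data.Nat.Properties
open import Data.Product.Base using (∃; ∃₂; _×_; _,_)
open import Data.Rational.Base as ℚ using (ℚ; 0ℚ; _/_)
open import Data.Rational.Properties using (normalize-pos; pos⇒nonZero; pos*pos⇒pos)
open import Level using (0ℓ)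
open import Relation.Binary.Core using (Rel)
open import Relation.Binary.Definitions using (Decidable; Symmetric; Irreflexive)
open import Relation.Binary.PropositionalEquality using (_≡_; _≢_; refl; sym; subst)
open import Relation.Nullary.Decidable using (_×-dec_; dec⇒maybe)
open import Relation.Nullary.Negation using (contradiction)
open import Relation.Unary using (Pred)

record Graph (n : ℕ) : Set₁ where
  infix 4 _~_ _~?_
  field
    _~_      : Rel (Fin n) 0ℓ
    _~?_     : Decidable _~_
    ~-sym    : Symmetric _~_
    ~-irrefl : Irreflexive _≡_ _~_

IsLeast : Pred ℕ 0ℓ → Pred ℕ 0ℓ
IsLeast P k = P k × (∀ {j} → P j → k ≤ j)

IsGreatest : Pred ℕ 0ℓ → Pred ℕ 0ℓ
IsGreatest P k = P k × (∀ {j} → P j → j ≤ k)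

sumℚ : List ℚ → ℚ
sumℚ = foldr ℚ._+_ 0ℚ

module _ {n : ℕ} (G : Graph n) where
  open Graph G

  -- The third index is the number of edges traversed.
  data Walk : Fin n → Fin n → ℕ → Set where
    []  : ∀ {u} → Walk u u 0
    _∷_ : ∀ {u v w k} → u ~ v → Walk v w k → Walk u w (suc k)

  Connected : Set
  Connected = ∀ u v → ∃ λ k → Walk u v k

  IsDistance : Fin n → Fin n → Pred ℕ 0ℓ
  IsDistance u v = IsLeast (Walk u v)

  IsEccentricity : Fin n → Pred ℕ 0ℓ
  IsEccentricity v = IsGreatest (λ k → ∃ λ u → u ≢ v × IsDistance v u k)

  IsRadius : Pred ℕ 0ℓ
  IsRadius = IsLeast (λ k → ∃ λ v → IsEccentricity v k)

  degree : Fin n → ℕ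
  degree i = length (filter (i ~?_) (allFin n))

  -- Orienting each edge from its smaller to its larger endpoint makes every
  -- unordered edge occur exactly once in the list of edges.
  Edge : Set
  Edge = ∃₂ λ i j → i Fin.< j × i ~ j

  edge? : Fin n × Fin n → Maybe Edge
  edge? (i , j) = Maybe.map (λ e → i , j , e) (dec⇒maybe ((i Fin.<? j) ×-dec (i ~? j)))

  edges : List Edge
  edges = mapMaybe edge? (cartesianProduct (allFin n) (allFin n))

  size : ℕ
  size = length edges

  sumSquaredDegrees : ℕ
  sumSquaredDegrees = sum (map (λ i → degree i ^ 2) (allFin n))

  ~⇒degree-nonZero : ∀ {i j} → i ~ j → NonZero (degree i)
  ~⇒degree-nonZero {i} {j} i~j = >-nonZero (filter-some (i ~?_) (lose (∈-allFin j) i~j))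

  edgeDegreeSum : Edge → ℕ
  edgeDegreeSum (i , j , _) = degree i + degree j

  edgeDegreeSum-nonZero : ∀ e → NonZero (edgeDegreeSum e)
  edgeDegreeSum-nonZero (i , j , _ , i~j) =
    >-nonZero (≤-trans (>-nonZero⁻¹ (degree i) {{~⇒degree-nonZero i~j}}) (m≤m+n (degree i) (degree j)))

  harmonicIndex : ℚ
  harmonicIndex = sumℚ (map (λ e → (+ 2 / edgeDegreeSum e) {{edgeDegreeSum-nonZero e}}) edges)

  4m²-nonZero : .{{NonZero size}} → NonZero (4 * size ^ 2)
  4m²-nonZero = m*n≢0 4 (size ^ 2) {{_}} {{m^n≢0 size 2}}

  ν : .{{NonZero size}} → ℚ
  ν = (+ (n * sumSquaredDegrees) / (4 * size ^ 2)) {{4m²-nonZero}}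

  private
    anEdge : .{{NonZero size}} → Edge
    anEdge with edges
    ... | e ∷ _ = e

    ∈⇒≤sum : ∀ {x xs} → x ∈ xs → x ≤ sum xs
    ∈⇒≤sum {x} {_ ∷ xs} (here refl)  = m≤m+n x (sum xs)
    ∈⇒≤sum {x} {y ∷ _}  (there x∈xs) = ≤-trans (∈⇒≤sum x∈xs) (m≤n+m _ y)

    n*Σd²-nonZero : Edge → NonZero (n * sumSquaredDegrees)
    n*Σd²-nonZero (i , _ , _ , i~j) = m*n≢0 n sumSquaredDegrees
      {{Fin.nonZeroIndex i}}
      {{>-nonZero (≤-trans (m^n>0 (degree i) {{~⇒degree-nonZero i~j}} 2)
                           (∈⇒≤sum (∈-map⁺ (λ k → degree k ^ 2) (∈-allFin i))))}}

  2ν-nonZero : .{{_ : NonZero size}} → ℚ.NonZero (+ 2 / 1 ℚ.* ν)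
  2ν-nonZero = pos⇒nonZero (+ 2 / 1 ℚ.* ν)
    {{pos*pos⇒pos (+ 2 / 1) ν
      {{normalize-pos (n * sumSquaredDegrees) (4 * size ^ 2) {{4m²-nonZero}} {{n*Σd²-nonZero anEdge}}}}}}

  private
    vertexAt : ∀ {u v k} → Walk u v k → Fin (suc k) → Fin n
    vertexAt {u} _       zero    = u
    vertexAt     (_ ∷ w) (suc i) = vertexAt w i

    splice : ∀ {u x v k l} (w : Walk u x k) (i : Fin (suc k)) →
             Walk (vertexAt w i) v l → Walk u v (toℕ i + l)
    splice _       zero    w′ = w′
    splice (e ∷ w) (suc i) w′ = e ∷ splice w i w′

    drop : ∀ {u v k} (w : Walk u v k) (i : Fin (suc k)) → Walk (vertexAt w i) v (k ∸ toℕ i)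
    drop w       zero    = w
    drop (_ ∷ w) (suc i) = drop w i

  distance<n : ∀ {u v k} → IsDistance u v k → k < n
  distance<n {k = k} (w , shortest) = ≰⇒> λ n≤k →
    let i , j , i<j , wᵢ≡wⱼ = pigeonhole (s≤s n≤k) (vertexAt w)
        w′ = splice w i (subst (λ x → Walk x _ (k ∸ toℕ j)) (sym wᵢ≡wⱼ) (drop w j))
        shorter = <-≤-trans (+-monoˡ-< (k ∸ toℕ j) i<j) (≤-reflexive (m+[n∸m]≡n (toℕ≤pred[n] j)))
    in contradiction (shortest w′) (<⇒≱ shorter)

  -- In particular r < n, so n ∸ r is the true difference n − r.
  n∸radius-nonZero : ∀ {r} → IsRadius r → NonZero (n ∸ r)
  n∸radius-nonZero ((_ , (_ , _ , d) , _) , _) = >-nonZero (m<n⇒0<n∸m (distance<n d))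

{-# OPTIONS --safe #-}
module Submission where

-- Write S = Σ dᵢ², so that n / 2ν = 2m² / S.  Since Σ (dᵢ + dⱼ) over the edges
-- equals S, the first inequality is the one between the harmonic and the
-- arithmetic mean of the numbers dᵢ + dⱼ.  For the second, a shortest walk from
-- i to a vertex at distance ecc(i) contains ecc(i) vertices not adjacent to i
-- (among them i itself), hence dᵢ ≤ n − ecc(i) ≤ n − r, and S ≤ (n − r) Σ dᵢ = 2m (n − r).

open import Defs
open import Data.Fin.Base as Fin using (Fin; zero; suc)
import Data.Fin.Properties as Fin
open import Data.Integer.Base as ℤ using (+_; +≤+)
import Data.Integer.Properties as ℤ
open import Data.List.Base using (List; []; _∷_; _++_; length; map; mapMaybe; filter; allFin; cartesianProduct; lookup)
open import Data.List.Extrema.Nat using (argmax; argmax-all; f[xs]≤f[argmax])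
open import Data.List.Membership.Propositional using (_∈_)
open import Data.List.Membership.Propositional.Properties using (∈-allFin; ∈-filter⁺; ∈-filter⁻; ∈-lookup)
open import Data.List.Properties using (length-++; map-++; map-∘; map-cong)
open import Data.List.Relation.Binary.Disjoint.Propositional using (Disjoint)
open import Data.List.Relation.Unary.All as All using (All; []; _∷_)
open import Data.List.Relation.Unary.All.Properties using (all-filter)
open import Data.List.Relation.Unary.AllPairs using ([]; _∷_)
open import Data.List.Relation.Unary.Any using (here; there)
open import Data.List.Relation.Unary.Unique.Propositional using (Unique)
open import Data.List.Relation.Unary.Unique.Propositional.Properties using (++⁺; filter⁺; allFin⁺)
open import Data.Maybe.Base using (Maybe; just; nothing; maybe′)
open import Data.Nat.Base using (ℕ; zero; suc; NonZero; _∸_; _+_; _^_; _≤_; _<_; s≤s; >-nonZero; >-nonZero⁻¹)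
import Data.Nat.Base as ℕ
open import Data.Nat.Induction using (<-rec)
open import Data.Nat.ListAction using (sum)
open import Data.Nat.ListAction.Properties using (sum-++)
import Data.Nat.Properties as ℕ
open import Data.Nat.Tactic.RingSolver using (solve-∀)
open import Data.Product.Base using (∃; _×_; _,_; proj₁; proj₂)
open import Data.Rational.Base as ℚ using (ℚ; _/_; _÷_; _*_; _≥_; toℚᵘ)
import Data.Rational.Properties as ℚ
open import Data.Rational.Solver using (module +-*-Solver)
open import Data.Rational.Unnormalised.Base as ℚᵘ using (mkℚᵘ; *≡*; *≤*)
import Data.Rational.Unnormalised.Properties as ℚᵘ
open import Data.Sum.Base using (inj₁; inj₂)
open import Function.Base using (_∘_; case_of_)
open import Function.Definitions using (Injective)
open import Level using (0ℓ)
open import Relation.Binary.PropositionalEquality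
open import Relation.Nullary.Decidable using (Dec; yes; no; map′; _×-dec_; ¬?)
open import Relation.Nullary.Negation using (contradiction)
open import Relation.Unary using (Pred; Decidable)

private
  variable
    A B : Set
    P   : Pred A 0ℓ

-- Sums over lists

χ : Dec A → ℕ
χ (yes _) = 1
χ (no _)  = 0

sum-map-+ : ∀ (f g : A → ℕ) xs → sum (map (λ x → f x + g x) xs) ≡ sum (map f xs) + sum (map g xs)
sum-map-+ f g []       = refl
sum-map-+ f g (x ∷ xs) = trans (cong (ℕ._+_ (f x + g x)) (sum-map-+ f g xs))
  (interchange (f x) (g x) (sum (map f xs)) (sum (map g xs)))
  where
  interchange : ∀ a b c d → a + b + (c + d) ≡ a + c + (b + d)
  interchange = solve-∀

sum-map-0 : ∀ (xs : List A) → sum (map (λ _ → 0) xs) ≡ 0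
sum-map-0 []       = refl
sum-map-0 (_ ∷ xs) = sum-map-0 xs

sum-swap : ∀ (h : A → B → ℕ) xs ys →
           sum (map (λ x → sum (map (h x) ys)) xs) ≡ sum (map (λ y → sum (map (λ x → h x y) xs)) ys)
sum-swap h []       ys = sym (sum-map-0 ys)
sum-swap h (x ∷ xs) ys = trans (cong (ℕ._+_ (sum (map (h x) ys))) (sum-swap h xs ys))
  (sym (sum-map-+ (h x) (λ y → sum (map (λ x → h x y) xs)) ys))

sum-map-cong : ∀ {f g : A → ℕ} → f ≗ g → ∀ xs → sum (map f xs) ≡ sum (map g xs)
sum-map-cong f≗g xs = cong sum (map-cong f≗g xs)

sum-map-mono : ∀ {f g : A → ℕ} → (∀ x → f x ≤ g x) → ∀ xs → sum (map f xs) ≤ sum (map g xs)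
sum-map-mono f≤g []       = ℕ.≤-refl
sum-map-mono f≤g (x ∷ xs) = ℕ.+-mono-≤ (f≤g x) (sum-map-mono f≤g xs)

sum-map-* : ∀ (f : A → ℕ) c xs → sum (map (λ x → f x ℕ.* c) xs) ≡ sum (map f xs) ℕ.* c
sum-map-* f c []       = refl
sum-map-* f c (x ∷ xs) = trans (cong (ℕ._+_ (f x ℕ.* c)) (sum-map-* f c xs))
  (sym (ℕ.*-distribʳ-+ c (f x) (sum (map f xs))))

sum-map-const : ∀ c (xs : List A) → sum (map (λ _ → c) xs) ≡ length xs ℕ.* c
sum-map-const c []       = refl
sum-map-const c (_ ∷ xs) = cong (ℕ._+_ c) (sum-map-const c xs)

-- Discarded elements count as 0. Since `edges` is a `mapMaybe` over a product, a sum over edges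
-- thereby becomes a double sum over ordered pairs of vertices.
sum-mapMaybe : ∀ (g : B → ℕ) (p : A → Maybe B) xs →
               sum (map g (mapMaybe p xs)) ≡ sum (map (λ x → maybe′ g 0 (p x)) xs)
sum-mapMaybe g p []       = refl
sum-mapMaybe g p (x ∷ xs) with p x
... | just y  = cong (ℕ._+_ (g y)) (sum-mapMaybe g p xs)
... | nothing = sum-mapMaybe g p xs

sum-cartesianProduct : ∀ (h : A × B → ℕ) xs ys →
  sum (map h (cartesianProduct xs ys)) ≡ sum (map (λ x → sum (map (λ y → h (x , y)) ys)) xs)
sum-cartesianProduct h []       ys = refl
sum-cartesianProduct h (x ∷ xs) ys = begin
  sum (map h (map (x ,_) ys ++ rest))               ≡⟨ cong sum (map-++ h (map (x ,_) ys) rest) ⟩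
  sum (map h (map (x ,_) ys) ++ map h rest)         ≡⟨ sum-++ (map h (map (x ,_) ys)) (map h rest) ⟩
  sum (map h (map (x ,_) ys)) + sum (map h rest)    ≡⟨ cong₂ _+_ (cong sum (sym (map-∘ ys))) (sum-cartesianProduct h xs ys) ⟩
  sum (map (λ y → h (x , y)) ys) + sum (map _ xs)   ∎
  where
  open ≡-Reasoning
  rest = cartesianProduct xs ys

sum-χ : ∀ (P? : Decidable P) xs → sum (map (χ ∘ P?) xs) ≡ length (filter P? xs)
sum-χ P? []       = refl
sum-χ P? (x ∷ xs) with P? x
... | yes _ = cong suc (sum-χ P? xs)
... | no  _ = sum-χ P? xs

-- Lists without repetition and least elements

lookup-injective : ∀ {xs : List A} → Unique xs → Injective _≡_ _≡_ (lookup xs)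
lookup-injective (_   ∷ _) {zero}  {zero}  _  = refl
lookup-injective (x∉  ∷ _) {zero}  {suc j} eq = contradiction eq (All.lookup x∉ (∈-lookup j))
lookup-injective (x∉  ∷ _) {suc i} {zero}  eq = contradiction (sym eq) (All.lookup x∉ (∈-lookup i))
lookup-injective (_ ∷ uxs) {suc i} {suc j} eq = cong suc (lookup-injective uxs eq)

-- The positions of the list embed into `Fin n` by `lookup`.
length-unique≤ : ∀ {n} {xs : List (Fin n)} → Unique xs → length xs ≤ n
length-unique≤ uxs = Fin.injective⇒≤ (lookup-injective uxs)

-- Strong induction on the witness: a bounded search below `k` either finds a smaller witness to
-- continue from or shows `k` to be minimal.
least : Decidable P → ∀ {k} → P k → ∃ (IsLeast P)
least {P = P} P? {k} = <-rec (λ k → P k → ∃ (IsLeast P)) step k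
  where
  step : ∀ k → (∀ {j} → j < k → P j → ∃ (IsLeast P)) → P k → ∃ (IsLeast P)
  step k rec pk with ℕ.anyUpTo? P? k
  ... | yes (j , j<k , pj) = rec j<k pj
  ... | no ¬smaller        = k , pk , λ {j} pj → ℕ.≮⇒≥ λ j<k → ¬smaller (j , j<k , pj)

IsLeast-unique : ∀ {j k} → IsLeast P j → IsLeast P k → j ≡ k
IsLeast-unique (pj , j-least) (pk , k-least) = ℕ.≤-antisym (j-least pk) (k-least pj)

-- Degrees, distances and eccentricities

module _ {n : ℕ} (G : Graph n) where
  open Graph G

  -- Double counting over edges

  private
    orientedEdge? : ∀ i j → Dec (i Fin.< j × i ~ j)
    orientedEdge? i j = (i Fin.<? j) ×-dec (i ~? j)

    -- By symmetry and irreflexivity, adjacent vertices are distinct and exactly one of the two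
    -- orders counts their edge; for non-adjacent ones every indicator vanishes.
    χ-orientations : ∀ i j → χ (orientedEdge? i j) + χ (orientedEdge? j i) ≡ χ (i ~? j)
    χ-orientations i j with i ~? j | j ~? i | i Fin.<? j | j Fin.<? i
    ... | yes i~j | no j≁i  | _       | _       = contradiction (~-sym i~j) j≁i
    ... | no i≁j  | yes j~i | _       | _       = contradiction (~-sym j~i) i≁j
    ... | yes _   | yes _   | yes i<j | yes j<i = contradiction j<i (ℕ.<-asym i<j)
    ... | yes _   | yes _   | yes _   | no _    = refl
    ... | yes _   | yes _   | no _    | yes _   = refl
    ... | yes i~j | yes _   | no i≮j  | no j≮i  =
      contradiction i~j (~-irrefl (Fin.toℕ-injective (ℕ.≤-antisym (ℕ.≮⇒≥ j≮i) (ℕ.≮⇒≥ i≮j))))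
    ... | no _    | no _    | yes _   | yes _   = refl
    ... | no _    | no _    | yes _   | no _    = refl
    ... | no _    | no _    | no _    | yes _   = refl
    ... | no _    | no _    | no _    | no _    = refl

  -- Each `f i` is counted once per edge at `i`. Degrees yield the sum of squared degrees, the
  -- constant 1 the handshake lemma.
  ∑-edges-endpoints : ∀ (f : Fin n → ℕ) →
    sum (map (λ (i , j , _) → f i + f j) (edges G)) ≡ sum (map (λ i → degree G i ℕ.* f i) (allFin n))
  ∑-edges-endpoints f = begin
    sum (map g (edges G))
      ≡⟨ sum-mapMaybe g (edge? G) (cartesianProduct V V) ⟩
    sum (map (λ p → maybe′ g 0 (edge? G p)) (cartesianProduct V V))
      ≡⟨ sum-cartesianProduct (λ p → maybe′ g 0 (edge? G p)) V V ⟩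
    ∑ (λ i → ∑ λ j → maybe′ g 0 (edge? G (i , j)))
      ≡⟨ ∑-cong (λ i → ∑-cong λ j → contribution i j) ⟩
    ∑ (λ i → ∑ λ j → c i j ℕ.* f i + c i j ℕ.* f j)
      ≡⟨ ∑-cong (λ i → sum-map-+ (λ j → c i j ℕ.* f i) (λ j → c i j ℕ.* f j) V) ⟩
    ∑ (λ i → ∑ (λ j → c i j ℕ.* f i) + ∑ (λ j → c i j ℕ.* f j))
      ≡⟨ sum-map-+ (λ i → ∑ λ j → c i j ℕ.* f i) (λ i → ∑ λ j → c i j ℕ.* f j) V ⟩
    ∑ (λ i → ∑ λ j → c i j ℕ.* f i) + ∑ (λ i → ∑ λ j → c i j ℕ.* f j)
      -- Exchanging the sums in the second half and renaming the indices makes both halves carry the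
      -- weight `f i`, so that the two orientations can be merged.
      ≡⟨ cong (ℕ._+_ (∑ (λ i → ∑ λ j → c i j ℕ.* f i))) (sum-swap (λ i j → c i j ℕ.* f j) V V) ⟩
    ∑ (λ i → ∑ λ j → c i j ℕ.* f i) + ∑ (λ i → ∑ λ j → c j i ℕ.* f i)
      ≡⟨ sum-map-+ (λ i → ∑ λ j → c i j ℕ.* f i) (λ i → ∑ λ j → c j i ℕ.* f i) V ⟨
    ∑ (λ i → ∑ (λ j → c i j ℕ.* f i) + ∑ (λ j → c j i ℕ.* f i))
      ≡⟨ ∑-cong (λ i → sum-map-+ (λ j → c i j ℕ.* f i) (λ j → c j i ℕ.* f i) V) ⟨
    ∑ (λ i → ∑ λ j → c i j ℕ.* f i + c j i ℕ.* f i)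
      ≡⟨ ∑-cong (λ i → ∑-cong λ j → trans (sym (ℕ.*-distribʳ-+ (f i) (c i j) (c j i)))
                                          (cong (ℕ._* f i) (χ-orientations i j))) ⟩
    ∑ (λ i → ∑ λ j → χ (i ~? j) ℕ.* f i)
      ≡⟨ ∑-cong (λ i → trans (sum-map-* (λ j → χ (i ~? j)) (f i) V)
                             (cong (ℕ._* f i) (sum-χ (i ~?_) V))) ⟩
    ∑ (λ i → degree G i ℕ.* f i) ∎
    where
    open ≡-Reasoning
    V = allFin n
    c : Fin n → Fin n → ℕ
    c i j = χ (orientedEdge? i j)
    g : Edge G → ℕ
    g (i , j , _) = f i + f j
    ∑ : (Fin n → ℕ) → ℕ
    ∑ h = sum (map h V)
    ∑-cong : ∀ {h k} → h ≗ k → ∑ h ≡ ∑ k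
    ∑-cong h≗k = sum-map-cong h≗k V
    contribution : ∀ i j → maybe′ g 0 (edge? G (i , j)) ≡ c i j ℕ.* f i + c i j ℕ.* f j
    contribution i j with orientedEdge? i j
    ... | yes _ = sym (cong₂ _+_ (ℕ.+-identityʳ (f i)) (ℕ.+-identityʳ (f j)))
    ... | no _  = refl

  ∑-edgeDegreeSum : sum (map (edgeDegreeSum G) (edges G)) ≡ sumSquaredDegrees G
  ∑-edgeDegreeSum = trans (∑-edges-endpoints (degree G))
    -- The square `degree G i ^ 2` unfolds to a product with a trailing factor 1.
    (sum-map-cong (λ i → cong (degree G i ℕ.*_) (sym (ℕ.*-identityʳ (degree G i)))) (allFin n))

  handshake : size G ℕ.* 2 ≡ sum (map (degree G) (allFin n))
  handshake = trans (sym (sum-map-const 2 (edges G))) (trans (∑-edges-endpoints (λ _ → 1))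
    (sum-map-cong (λ i → ℕ.*-identityʳ (degree G i)) (allFin n)))

  -- Every edge contributes at least 1 to the sum of the edge degree sums. This makes
  -- `sumSquaredDegrees G` nonzero, hence cancellable.
  size≤sumSquaredDegrees : size G ≤ sumSquaredDegrees G
  size≤sumSquaredDegrees = begin
    size G                                  ≡⟨ ℕ.*-identityʳ (size G) ⟨
    size G ℕ.* 1                            ≡⟨ sum-map-const 1 (edges G) ⟨
    sum (map (λ _ → 1) (edges G))           ≤⟨ sum-map-mono (λ e → >-nonZero⁻¹ _ {{edgeDegreeSum-nonZero G e}}) (edges G) ⟩
    sum (map (edgeDegreeSum G) (edges G))   ≡⟨ ∑-edgeDegreeSum ⟩
    sumSquaredDegrees G                     ∎
    where open ℕ.≤-Reasoning

  -- Distances and eccentricities in a connected graph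

  walk? : ∀ u v → Decidable (Walk G u v)
  walk? u v zero    = map′ (λ { refl → [] }) (λ { [] → refl }) (u Fin.≟ v)
  walk? u v (suc k) = map′ (λ { (_ , e , w) → e ∷ w }) (λ { (e ∷ w) → _ , e , w })
    (Fin.any? λ x → (u ~? x) ×-dec walk? x v k)

  -- Connectedness supplies some walk; as walks of a given length are decidable, `least` turns its
  -- length into the minimal one.
  distance : Connected G → ∀ u v → ∃ (IsDistance G u v)
  distance conn u v = least (walk? u v) (proj₂ (conn u v))

  eccentricity : Connected G → ∀ {u v} → u ≢ v → ∃ (IsEccentricity G v)
  eccentricity conn {u} {v} u≢v = δ far , (far , far≢v , proj₂ (distance conn v far)) , greatest
    where
    δ : Fin n → ℕ
    δ x = proj₁ (distance conn v x)
    ≢v? : Decidable (_≢ v)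
    ≢v? x = ¬? (x Fin.≟ v)
    others = filter ≢v? (allFin n)
    -- The default value `u` also differs from `v`, so `far` does so in every case.
    far = argmax δ u others
    far≢v : far ≢ v
    far≢v = argmax-all δ {P = _≢ v} u≢v (all-filter ≢v? (allFin n))
    greatest : ∀ {j} → (∃ λ x → x ≢ v × IsDistance G v x j) → j ≤ δ far
    greatest (x , x≢v , d) = ℕ.≤-trans
      (ℕ.≤-reflexive (IsLeast-unique {P = Walk G v x} d (proj₂ (distance conn v x))))
      (All.lookup (f[xs]≤f[argmax] u others) (∈-filter⁺ ≢v? (∈-allFin x) x≢v))

  -- Vertices of shortest walks

  vertices : ∀ {u v k} → Walk G u v k → List (Fin n)
  vertices {u} []      = u ∷ []
  vertices {u} (_ ∷ w) = u ∷ vertices w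

  length-vertices : ∀ {u v k} (w : Walk G u v k) → length (vertices w) ≡ suc k
  length-vertices []      = refl
  length-vertices (_ ∷ w) = cong suc (length-vertices w)

  vertices-close : ∀ {u v k} (w : Walk G u v k) →
                   All (λ x → ∃ λ l → l ≤ k × Walk G x v l) (vertices w)
  vertices-close []      = (_ , ℕ.≤-refl , []) ∷ []
  vertices-close (e ∷ w) = (_ , ℕ.≤-refl , e ∷ w) ∷
    All.map (λ (l , l≤k , w′) → l , ℕ.m≤n⇒m≤1+n l≤k , w′) (vertices-close w)

  Shortest : Fin n → Fin n → ℕ → Set
  Shortest u v k = ∀ {j} → Walk G u v j → k ≤ j

  -- A shorter walk from `x`, prefixed with the edge, would be a shorter walk from `u`.
  shortest-tail : ∀ {u x v k} → u ~ x → Shortest u v (suc k) → Shortest x v k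
  shortest-tail e shortest w = ℕ.s≤s⁻¹ (shortest (e ∷ w))

  -- If `u` lay on `w`, the rest of `w` would lead from `u` to `v` in at most `k` steps, fewer than
  -- `d`.
  farther⇒∉vertices : ∀ {u x v k d} (w : Walk G x v k) → k < d → Shortest u v d → All (u ≢_) (vertices w)
  farther⇒∉vertices w k<d shortest = All.map
    (λ { (l , l≤k , w′) refl → ℕ.<⇒≱ (ℕ.≤-<-trans l≤k k<d) (shortest w′) }) (vertices-close w)

  vertices-unique : ∀ {u v k} (w : Walk G u v k) → Shortest u v k → Unique (vertices w)
  vertices-unique []      _        = [] ∷ []
  vertices-unique (e ∷ w) shortest =
    farther⇒∉vertices w ℕ.≤-refl shortest ∷ vertices-unique w (shortest-tail e shortest)

  -- On a shortest walk from v only the second vertex is a neighbour of v.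
  degree+distance≤n : ∀ {v u k} → IsDistance G v u k → degree G v + k ≤ n
  degree+distance≤n {v} {u} {k} (walk , shortest) = bound walk shortest
    where
    open ℕ.≤-Reasoning
    N = filter (v ~?_) (allFin n)

    N-unique : Unique N
    N-unique = filter⁺ (v ~?_) (allFin⁺ n)

    N-adjacent : ∀ {x} → x ∈ N → v ~ x
    N-adjacent x∈N = proj₂ (∈-filter⁻ (v ~?_) {xs = allFin n} x∈N)

    -- The list `xs` collects `k` vertices that are not neighbours of `v`; together with `N` it has
    -- no repetitions.
    extend : ∀ {xs k} → length xs ≡ k → Unique xs → Disjoint N xs → degree G v + k ≤ n
    extend {xs} {k} refl xs-unique disjoint = begin
      length N + length xs   ≡⟨ length-++ N ⟨
      length (N ++ xs)       ≤⟨ length-unique≤ (++⁺ N-unique xs-unique disjoint) ⟩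
      n                      ∎

    bound : ∀ {k} → Walk G v u k → Shortest v u k → degree G v + k ≤ n
    bound [] _ = extend {xs = []} refl [] λ ()
    bound (e ∷ []) _ = extend {xs = v ∷ []} refl ([] ∷ [])
      λ { (v∈N , here refl) → ~-irrefl refl (N-adjacent v∈N) }
    -- Dropping the second vertex leaves `v` and the `suc k` vertices of `w`, which is as many as
    -- the length of the walk.
    bound {suc (suc k)} (e ∷ e′ ∷ w) shortest = extend {xs = v ∷ vertices w} (cong suc (length-vertices w))
      (farther⇒∉vertices w (ℕ.m<n⇒m<1+n ℕ.≤-refl) shortest
        ∷ vertices-unique w (shortest-tail e′ (shortest-tail e shortest)))
      λ { (x∈N , here refl) → ~-irrefl refl (N-adjacent x∈N)
        -- A neighbour of `v` on `w` would give a walk from `v` of length at most `suc k`, below the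
        -- distance `suc (suc k)`.
        ; (x∈N , there x∈w) → let l , l≤k , w′ = All.lookup (vertices-close w) x∈w
                              in ℕ.<⇒≱ (s≤s (s≤s l≤k)) (shortest (N-adjacent x∈N ∷ w′)) }

  degree≤n∸radius : Connected G → ∀ {r} → IsRadius G r → ∀ i → degree G i ≤ n ∸ r
  degree≤n∸radius conn {r} ((c , (u , u≢c , _) , _) , minimal) i =
    ℕ.m+n≤o⇒m≤o∸n (degree G i) (ℕ.≤-trans (ℕ.+-monoʳ-≤ (degree G i) (minimal (i , isEcc)))
                                          (degree+distance≤n (proj₂ (proj₂ (proj₁ isEcc)))))
    where
    -- An eccentricity of `i` requires a second vertex. The witness of the radius contains two
    -- distinct vertices `c` and `u`, at least one of which is not `i`.
    other : ∃ λ x → x ≢ i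
    other with u Fin.≟ i
    ... | no u≢i   = u , u≢i
    ... | yes refl = c , u≢c ∘ sym
    isEcc = proj₂ (eccentricity conn (proj₂ other))

  sumSquaredDegrees≤ : Connected G → ∀ {r} → IsRadius G r →
                       sumSquaredDegrees G ≤ 2 ℕ.* size G ℕ.* (n ∸ r)
  sumSquaredDegrees≤ conn {r} rad = begin
    sumSquaredDegrees G
      ≤⟨ sum-map-mono (λ i → ℕ.*-monoʳ-≤ (degree G i) (ℕ.≤-trans (ℕ.≤-reflexive (ℕ.*-identityʳ _))
                                                                 (degree≤n∸radius conn rad i))) (allFin n) ⟩
    sum (map (λ i → degree G i ℕ.* (n ∸ r)) (allFin n))
      ≡⟨ sum-map-* (degree G) (n ∸ r) (allFin n) ⟩
    sum (map (degree G) (allFin n)) ℕ.* (n ∸ r)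
      ≡⟨ cong (ℕ._* (n ∸ r)) (trans (sym handshake) (ℕ.*-comm (size G) 2)) ⟩
    2 ℕ.* size G ℕ.* (n ∸ r) ∎
    where open ℕ.≤-Reasoning

-- Rational arithmetic

-- Once denominators are cleared, polynomial identities are settled in ℕ and transported along this
-- embedding.
ι : ℕ → ℚ
ι k = + k / 1

-- Division in ℚ reduces to lowest terms, so the two fractions agree only up to `≃`. Passing to
-- unnormalised fractions reduces claims to cross-multiplication.
toℚᵘ-/ : ∀ a b .{{_ : NonZero b}} → toℚᵘ (+ a / b) ℚᵘ.≃ (+ a ℚᵘ./ b)
toℚᵘ-/ a (suc b) = ℚ.toℚᵘ-fromℚᵘ (mkℚᵘ (+ a) b)

ι-+ : ∀ a b → ι (a + b) ≡ ι a ℚ.+ ι b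
ι-+ a b = ℚ.toℚᵘ-injective (begin
  toℚᵘ (ι (a + b))                 ≈⟨ toℚᵘ-/ (a + b) 1 ⟩
  + (a + b) ℚᵘ./ 1                 ≈⟨ *≡* (cong (ℤ._* + 1) (sym (cong₂ ℤ._+_ (ℤ.*-identityʳ (+ a)) (ℤ.*-identityʳ (+ b))))) ⟩
  (+ a ℚᵘ./ 1) ℚᵘ.+ (+ b ℚᵘ./ 1)   ≈⟨ ℚᵘ.+-cong (toℚᵘ-/ a 1) (toℚᵘ-/ b 1) ⟨
  toℚᵘ (ι a) ℚᵘ.+ toℚᵘ (ι b)       ≈⟨ ℚ.toℚᵘ-homo-+ (ι a) (ι b) ⟨
  toℚᵘ (ι a ℚ.+ ι b)               ∎)
  where open import Relation.Binary.Reasoning.Setoid ℚᵘ.≃-setoid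

ι-* : ∀ a b → ι (a ℕ.* b) ≡ ι a * ι b
ι-* a b = ℚ.toℚᵘ-injective (begin
  toℚᵘ (ι (a ℕ.* b))               ≈⟨ toℚᵘ-/ (a ℕ.* b) 1 ⟩
  + (a ℕ.* b) ℚᵘ./ 1               ≈⟨ *≡* (cong (ℤ._* + 1) (ℤ.pos-* a b)) ⟩
  (+ a ℚᵘ./ 1) ℚᵘ.* (+ b ℚᵘ./ 1)   ≈⟨ ℚᵘ.*-cong (toℚᵘ-/ a 1) (toℚᵘ-/ b 1) ⟨
  toℚᵘ (ι a) ℚᵘ.* toℚᵘ (ι b)       ≈⟨ ℚ.toℚᵘ-homo-* (ι a) (ι b) ⟨
  toℚᵘ (ι a * ι b)                 ∎)
  where open import Relation.Binary.Reasoning.Setoid ℚᵘ.≃-setoid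

ι-mono-≤ : ∀ {a b} → a ≤ b → ι a ℚ.≤ ι b
ι-mono-≤ {a} {b} a≤b = ℚ.toℚᵘ-cancel-≤ (begin
  toℚᵘ (ι a)   ≃⟨ toℚᵘ-/ a 1 ⟩
  + a ℚᵘ./ 1   ≤⟨ *≤* (ℤ.*-monoʳ-≤-nonNeg (+ 1) (+≤+ a≤b)) ⟩
  + b ℚᵘ./ 1   ≃⟨ toℚᵘ-/ b 1 ⟨
  toℚᵘ (ι b)   ∎)
  where open ℚᵘ.≤-Reasoning

ι-pos : ∀ a .{{_ : NonZero a}} → ℚ.Positive (ι a)
ι-pos a = ℚ.normalize-pos a 1

/-*-ι : ∀ a b .{{_ : NonZero b}} → (+ a / b) * ι b ≡ ι a
/-*-ι a b@(suc _) = ℚ.toℚᵘ-injective (begin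
  toℚᵘ ((+ a / b) * ι b)            ≈⟨ ℚ.toℚᵘ-homo-* (+ a / b) (ι b) ⟩
  toℚᵘ (+ a / b) ℚᵘ.* toℚᵘ (ι b)    ≈⟨ ℚᵘ.*-cong (toℚᵘ-/ a b) (toℚᵘ-/ b 1) ⟩
  (+ a ℚᵘ./ b) ℚᵘ.* (+ b ℚᵘ./ 1)    ≈⟨ *≡* (ℤ.*-assoc (+ a) (+ b) (+ 1)) ⟩
  + a ℚᵘ./ 1                        ≈⟨ toℚᵘ-/ a 1 ⟨
  toℚᵘ (ι a)                        ∎)
  where open import Relation.Binary.Reasoning.Setoid ℚᵘ.≃-setoid

÷-*-cancel : ∀ p q .{{_ : ℚ.NonZero q}} → (p ÷ q) * q ≡ p
÷-*-cancel p q = trans (ℚ.*-assoc p (ℚ.1/ q) q) (trans (cong (p *_) (ℚ.*-inverseˡ q)) (ℚ.*-identityʳ p))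

*-cancelʳ-≡-pos : ∀ {p q} r → ℚ.Positive r → p * r ≡ q * r → p ≡ q
*-cancelʳ-≡-pos r r>0 eq = ℚ.≤-antisym (ℚ.*-cancelʳ-≤-pos r {{r>0}} (ℚ.≤-reflexive eq))
                                        (ℚ.*-cancelʳ-≤-pos r {{r>0}} (ℚ.≤-reflexive (sym eq)))

+-cancelʳ-≤ : ∀ r {p q} → p ℚ.+ r ℚ.≤ q ℚ.+ r → p ℚ.≤ q
+-cancelʳ-≤ r {p} {q} le = subst₂ ℚ._≤_ (cancel p) (cancel q) (ℚ.+-monoˡ-≤ (ℚ.- r) le)
  where
  cancel : ∀ p → p ℚ.+ r ℚ.+ (ℚ.- r) ≡ p
  cancel p = trans (ℚ.+-assoc p r (ℚ.- r)) (trans (cong (p ℚ.+_) (ℚ.+-inverseʳ r)) (ℚ.+-identityʳ p))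

-- The inequality between harmonic and arithmetic mean

2ab≤a²+b² : ∀ a b → 2 ℕ.* (a ℕ.* b) ≤ a ℕ.* a + b ℕ.* b
2ab≤a²+b² a b = case ℕ.≤-total a b of λ
  { (inj₁ a≤b) → ordered a≤b
  ; (inj₂ b≤a) → subst₂ _≤_ (cong (2 ℕ.*_) (ℕ.*-comm b a)) (ℕ.+-comm (b ℕ.* b) (a ℕ.* a)) (ordered b≤a)
  }
  where
  -- Subtraction is avoided by writing the larger number as `a + d`; the two sides then differ by
  -- `d * d`.
  square : ∀ a d → a ℕ.* a + (a + d) ℕ.* (a + d) ≡ 2 ℕ.* (a ℕ.* (a + d)) + d ℕ.* d
  square = solve-∀
  ordered : ∀ {a b} → a ≤ b → 2 ℕ.* (a ℕ.* b) ≤ a ℕ.* a + b ℕ.* b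
  ordered {a} a≤b with d , refl ← ℕ.m≤n⇒∃[o]m+o≡n a≤b =
    ℕ.≤-trans (ℕ.m≤m+n _ (d ℕ.* d)) (ℕ.≤-reflexive (sym (square a d)))

-- The tangent line to s ↦ c / s at s = S / m, scaled by S².
tangent : ∀ c m S s .{{_ : NonZero s}} →
          ι (c ℕ.* (2 ℕ.* m ℕ.* S)) ℚ.≤ (+ c / s) * ι (S ℕ.* S) ℚ.+ ι (c ℕ.* (m ℕ.* m) ℕ.* s)
tangent c m S s = ℚ.*-cancelʳ-≤-pos (ι s) {{ι-pos s}} (begin
  ι (c ℕ.* (2 ℕ.* m ℕ.* S)) * ι s
    ≡⟨ ι-* (c ℕ.* (2 ℕ.* m ℕ.* S)) s ⟨
  ι (c ℕ.* (2 ℕ.* m ℕ.* S) ℕ.* s)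
    ≡⟨ cong ι (lhs c m S s) ⟩
  ι (c ℕ.* (2 ℕ.* (S ℕ.* (m ℕ.* s))))
    -- After multiplication by `s`, the claim is that `c` times the square of the difference of `S`
    -- and `m * s` is nonnegative.
    ≤⟨ ι-mono-≤ (ℕ.*-monoʳ-≤ c (2ab≤a²+b² S (m ℕ.* s))) ⟩
  ι (c ℕ.* (S ℕ.* S + m ℕ.* s ℕ.* (m ℕ.* s)))
    ≡⟨ cong ι (rhs c m S s) ⟩
  ι (c ℕ.* (S ℕ.* S) + c ℕ.* (m ℕ.* m) ℕ.* s ℕ.* s)
    ≡⟨ trans (ι-+ (c ℕ.* (S ℕ.* S)) (c ℕ.* (m ℕ.* m) ℕ.* s ℕ.* s))
             (cong₂ ℚ._+_ (ι-* c (S ℕ.* S)) (ι-* (c ℕ.* (m ℕ.* m) ℕ.* s) s)) ⟩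
  ι c * ι (S ℕ.* S) ℚ.+ ι (c ℕ.* (m ℕ.* m) ℕ.* s) * ι s
    ≡⟨ cong (λ x → x * ι (S ℕ.* S) ℚ.+ ι (c ℕ.* (m ℕ.* m) ℕ.* s) * ι s) (/-*-ι c s) ⟨
  (+ c / s) * ι s * ι (S ℕ.* S) ℚ.+ ι (c ℕ.* (m ℕ.* m) ℕ.* s) * ι s
    ≡⟨ solve 4 (λ x y z w → x :* y :* z :+ w :* y := (x :* z :+ w) :* y) refl (+ c / s) (ι s) (ι (S ℕ.* S)) (ι (c ℕ.* (m ℕ.* m) ℕ.* s)) ⟩
  ((+ c / s) * ι (S ℕ.* S) ℚ.+ ι (c ℕ.* (m ℕ.* m) ℕ.* s)) * ι s ∎)
  where
  open ℚ.≤-Reasoning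
  open +-*-Solver
  lhs : ∀ c m S s → c ℕ.* (2 ℕ.* m ℕ.* S) ℕ.* s ≡ c ℕ.* (2 ℕ.* (S ℕ.* (m ℕ.* s)))
  lhs = solve-∀
  rhs : ∀ c m S s → c ℕ.* (S ℕ.* S + m ℕ.* s ℕ.* (m ℕ.* s)) ≡ c ℕ.* (S ℕ.* S) + c ℕ.* (m ℕ.* m) ℕ.* s ℕ.* s
  rhs = solve-∀

module _ (s : A → ℕ) (s≢0 : ∀ x → NonZero (s x)) (c : ℕ) where

  private
    reciprocals : List A → ℚ
    reciprocals xs = sumℚ (map (λ x → (+ c / s x) {{s≢0 x}}) xs)

  -- The point of tangency must stay fixed while the list shrinks in the induction, so `m` and `S`
  -- are independent of `xs` here.
  sum-tangent : ∀ m S xs → ι (length xs ℕ.* (c ℕ.* (2 ℕ.* m ℕ.* S))) ℚ.≤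
                reciprocals xs * ι (S ℕ.* S) ℚ.+ ι (c ℕ.* (m ℕ.* m) ℕ.* sum (map s xs))
  sum-tangent m S [] = ℚ.≤-reflexive (sym (begin
    ℚ.0ℚ * ι (S ℕ.* S) ℚ.+ ι (c ℕ.* (m ℕ.* m) ℕ.* 0)   ≡⟨ cong₂ ℚ._+_ (ℚ.*-zeroˡ (ι (S ℕ.* S))) (cong ι (ℕ.*-zeroʳ (c ℕ.* (m ℕ.* m)))) ⟩
    ι 0                                                ∎))
    where open ≡-Reasoning
  sum-tangent m S (x ∷ xs) = begin
    ι (t + length xs ℕ.* t)                         ≡⟨ ι-+ t (length xs ℕ.* t) ⟩
    ι t ℚ.+ ι (length xs ℕ.* t)                     ≤⟨ ℚ.+-mono-≤ (tangent c m S (s x) {{s≢0 x}}) (sum-tangent m S xs) ⟩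
    (y * S² ℚ.+ ι (k ℕ.* s x)) ℚ.+ (Y * S² ℚ.+ ι (k ℕ.* Σs))
      ≡⟨ solve 5 (λ y z a Y b → (y :* z :+ a) :+ (Y :* z :+ b) := (y :+ Y) :* z :+ (a :+ b)) refl y S² (ι (k ℕ.* s x)) Y (ι (k ℕ.* Σs)) ⟩
    (y ℚ.+ Y) * S² ℚ.+ (ι (k ℕ.* s x) ℚ.+ ι (k ℕ.* Σs))
      ≡⟨ cong ((y ℚ.+ Y) * S² ℚ.+_) (trans (sym (ι-+ (k ℕ.* s x) (k ℕ.* Σs))) (cong ι (sym (ℕ.*-distribˡ-+ k (s x) Σs)))) ⟩
    (y ℚ.+ Y) * S² ℚ.+ ι (k ℕ.* (s x + Σs))         ∎
    where
    open ℚ.≤-Reasoning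
    open +-*-Solver
    t  = c ℕ.* (2 ℕ.* m ℕ.* S)
    k  = c ℕ.* (m ℕ.* m)
    S² = ι (S ℕ.* S)
    y  = (+ c / s x) {{s≢0 x}}
    Y  = reciprocals xs
    Σs = sum (map s xs)

  -- With `m` the length and `S` the sum, `sum-tangent` reads `2kS ≤ H S² + kS` for `k = c m²`;
  -- cancelling `kS` and then one factor `S` remains.
  harmonicMean≤arithmeticMean : ∀ xs → .{{_ : NonZero (sum (map s xs))}} →
    ι (c ℕ.* (length xs ℕ.* length xs)) ℚ.≤ reciprocals xs * ι (sum (map s xs))
  harmonicMean≤arithmeticMean xs = ℚ.*-cancelʳ-≤-pos (ι S) {{ι-pos S}} (+-cancelʳ-≤ (ι (k ℕ.* S)) (begin
    ι k * ι S ℚ.+ ι (k ℕ.* S)                 ≡⟨ cong (ℚ._+ ι (k ℕ.* S)) (ι-* k S) ⟨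
    ι (k ℕ.* S) ℚ.+ ι (k ℕ.* S)               ≡⟨ ι-+ (k ℕ.* S) (k ℕ.* S) ⟨
    ι (k ℕ.* S + k ℕ.* S)                     ≡⟨ cong ι (double c m S) ⟩
    ι (m ℕ.* (c ℕ.* (2 ℕ.* m ℕ.* S)))         ≤⟨ sum-tangent m S xs ⟩
    H * ι (S ℕ.* S) ℚ.+ ι (k ℕ.* S)           ≡⟨ cong (λ z → H * z ℚ.+ ι (k ℕ.* S)) (ι-* S S) ⟩
    H * (ι S * ι S) ℚ.+ ι (k ℕ.* S)           ≡⟨ cong (ℚ._+ ι (k ℕ.* S)) (ℚ.*-assoc H (ι S) (ι S)) ⟨
    H * ι S * ι S ℚ.+ ι (k ℕ.* S)             ∎))
    where
    open ℚ.≤-Reasoning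
    m = length xs
    S = sum (map s xs)
    H = reciprocals xs
    k = c ℕ.* (m ℕ.* m)
    double : ∀ c m S → c ℕ.* (m ℕ.* m) ℕ.* S + c ℕ.* (m ℕ.* m) ℕ.* S ≡ m ℕ.* (c ℕ.* (2 ℕ.* m ℕ.* S))
    double = solve-∀

-- The three quantities of the theorem, multiplied by the sum of squared degrees

module _ {n : ℕ} (G : Graph n) .{{_ : NonZero (size G)}} where

  private
    m = size G
    S = sumSquaredDegrees G

  sumSquaredDegrees-nonZero : NonZero S
  sumSquaredDegrees-nonZero = >-nonZero (ℕ.<-≤-trans (>-nonZero⁻¹ m) (size≤sumSquaredDegrees G))

  n/2ν*S≡2m² : .{{_ : NonZero n}} →
               ((+ n / 1) ÷ (+ 2 / 1 * ν G)) {{2ν-nonZero G}} * ι S ≡ ι (2 ℕ.* (m ℕ.* m))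
  -- The factor `2 * n` supplies the 2 that completes the denominator `2ν` and the `n` that turns
  -- `S` into `n * S`, the numerator of `ν`.
  n/2ν*S≡2m² = *-cancelʳ-≡-pos (ι (2 ℕ.* n)) (ι-pos (2 ℕ.* n) {{ℕ.m*n≢0 2 n}}) (begin
    K * ι S * ι (2 ℕ.* n)                   ≡⟨ cong (K * ι S *_) (ι-* 2 n) ⟩
    K * ι S * (ι 2 * ι n)                   ≡⟨ solve 4 (λ K S t n → K :* S :* (t :* n) := K :* t :* (n :* S)) refl K (ι S) (ι 2) (ι n) ⟩
    K * ι 2 * (ι n * ι S)                   ≡⟨ cong (K * ι 2 *_) (trans (sym (ι-* n S)) (sym (/-*-ι (n ℕ.* S) (4 ℕ.* m ^ 2) {{4m²-nonZero G}}))) ⟩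
    K * ι 2 * (ν G * ι (4 ℕ.* m ^ 2))       ≡⟨ solve 4 (λ K t v q → K :* t :* (v :* q) := K :* (t :* v) :* q) refl K (ι 2) (ν G) (ι (4 ℕ.* m ^ 2)) ⟩
    K * (ι 2 * ν G) * ι (4 ℕ.* m ^ 2)       ≡⟨ cong (_* ι (4 ℕ.* m ^ 2)) (÷-*-cancel (ι n) (ι 2 * ν G) {{2ν-nonZero G}}) ⟩
    ι n * ι (4 ℕ.* m ^ 2)                   ≡⟨ ι-* n (4 ℕ.* m ^ 2) ⟨
    ι (n ℕ.* (4 ℕ.* m ^ 2))                 ≡⟨ cong ι (rearrange n m) ⟩
    ι (2 ℕ.* (m ℕ.* m) ℕ.* (2 ℕ.* n))       ≡⟨ ι-* (2 ℕ.* (m ℕ.* m)) (2 ℕ.* n) ⟩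
    ι (2 ℕ.* (m ℕ.* m)) * ι (2 ℕ.* n)       ∎)
    where
    open ≡-Reasoning
    open +-*-Solver
    K = ((+ n / 1) ÷ (+ 2 / 1 * ν G)) {{2ν-nonZero G}}
    rearrange : ∀ n m → n ℕ.* (4 ℕ.* (m ℕ.* (m ℕ.* 1))) ≡ 2 ℕ.* (m ℕ.* m) ℕ.* (2 ℕ.* n)
    rearrange = solve-∀

  -- The mean inequality for the edge degree sums, whose total is `S`; the constant 2 is the
  -- numerator in the harmonic index.
  2m²≤H*S : ι (2 ℕ.* (m ℕ.* m)) ℚ.≤ harmonicIndex G * ι S
  2m²≤H*S = subst (λ S → ι (2 ℕ.* (m ℕ.* m)) ℚ.≤ harmonicIndex G * ι S) (∑-edgeDegreeSum G)
    (harmonicMean≤arithmeticMean (edgeDegreeSum G) (edgeDegreeSum-nonZero G) 2 (edges G)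
      {{subst NonZero (sym (∑-edgeDegreeSum G)) sumSquaredDegrees-nonZero}})

  m/[n∸r]*S≤2m² : Connected G → ∀ {r} (rad : IsRadius G r) →
    (+ m / (n ∸ r)) {{n∸radius-nonZero G rad}} * ι S ℚ.≤ ι (2 ℕ.* (m ℕ.* m))
  m/[n∸r]*S≤2m² conn {r} rad = ℚ.*-cancelʳ-≤-pos (ι D) {{ι-pos D {{D≢0}}}} (begin
    y * ι S * ι D                   ≡⟨ solve 3 (λ y S D → y :* S :* D := y :* D :* S) refl y (ι S) (ι D) ⟩
    y * ι D * ι S                   ≡⟨ cong (_* ι S) (/-*-ι m D {{D≢0}}) ⟩
    ι m * ι S                       ≡⟨ ι-* m S ⟨
    ι (m ℕ.* S)                     ≤⟨ ι-mono-≤ (ℕ.*-monoʳ-≤ m (sumSquaredDegrees≤ G conn rad)) ⟩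
    ι (m ℕ.* (2 ℕ.* m ℕ.* D))       ≡⟨ cong ι (rearrange m D) ⟩
    ι (2 ℕ.* (m ℕ.* m) ℕ.* D)       ≡⟨ ι-* (2 ℕ.* (m ℕ.* m)) D ⟩
    ι (2 ℕ.* (m ℕ.* m)) * ι D       ∎)
    where
    open ℚ.≤-Reasoning
    open +-*-Solver
    D = n ∸ r
    D≢0 = n∸radius-nonZero G rad
    y = (+ m / D) {{D≢0}}
    rearrange : ∀ m D → m ℕ.* (2 ℕ.* m ℕ.* D) ≡ 2 ℕ.* (m ℕ.* m) ℕ.* D
    rearrange = solve-∀

theorem6 : ∀ {n} (G : Graph n) .{{_ : NonZero (size G)}} → Connected G →
    ∀ {r} (r-radius : IsRadius G r) →
    (harmonicIndex G ≥ ((+ n / 1) ÷ (+ 2 / 1 * ν G)) {{2ν-nonZero G}})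
    × (((+ n / 1) ÷ (+ 2 / 1 * ν G)) {{2ν-nonZero G}}
    ≥ (+ size G / (n ∸ r)) {{n∸radius-nonZero G r-radius}})
theorem6 {n} G conn r-radius@((v , _) , _) =
    -- Both inequalities are compared after multiplication by `S`, where the middle term becomes
    -- `2m²`.
    ℚ.*-cancelʳ-≤-pos (ι S) {{S>0}} (ℚ.≤-trans (ℚ.≤-reflexive K*S≡2m²) (2m²≤H*S G))
  , ℚ.*-cancelʳ-≤-pos (ι S) {{S>0}} (ℚ.≤-trans (m/[n∸r]*S≤2m² G conn r-radius) (ℚ.≤-reflexive (sym K*S≡2m²)))
  where
  S = sumSquaredDegrees G
  S>0 = ι-pos S {{sumSquaredDegrees-nonZero G}}
  -- The vertex `v` attaining the radius shows that `n` is nonzero.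
  instance
    n≢0 : NonZero n
    n≢0 = Fin.nonZeroIndex v
  K*S≡2m² = n/2ν*S≡2m² G
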